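{- There is a constant $d_0$ such that any (probabilistic bounded error or deterministic) symbolic algorithm that computes the strongly connected components of directed graphs with $n$ vertices and diameter at most $d_0$ needs $\Omega(n)$ symbolic one-step operations. That is, the $\Omega(n)$ lower bound for computing strongly connected components holds even for graphs of constant diameter.
   Context: Symbolic model: the input is a finite directed graph $G=(V,E)$ (self-loops allowed), $n=|V|$. The algorithm knows $V$, but it can access $E$ only through the one-step operations $\mathrm{Pre}(S)=\{v\in V\mid \exists s\in S:(v,s)\in E\}$ and $\mathrm{Post}(S)=\{v\in V\mid \exists s\in S:(s,v)\in E\}$ applied to (adaptively chosen) sets $S\subseteq V$. All other computation, in particular basic set operations such as $\cup,\cap,\setminus,\subseteq,=$ on vertex sets, is unrestricted and not counted in lower bounds; any number of sets may be stored. A probabilistic bounded error algorithm may use random bits and must be correct with probability at least $2/3$ on every (admissible) input. Convention for lower bounds: "needs $\Omega(n)$ one-step operations" on a class of inputs means: there is an absolute constant $c>0$ such that every (deterministic or probabilistic bounded error) symbolic algorithm that is correct on all inputs of the class performs, on inputs of the class with arbitrarily large $n$, at least $c\cdot n$ one-step operations (worst case over its random choices). The diameter of $G$ is the largest finite distance: the maximum of $d(u,v)$ over all pairs $u,v$ such that $u$ can reach $v$, where $d(u,v)$ is the smallest number of edges on a path from $u$ to $v$. -}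

module Defs where

open import Data.Bool using (Bool; T)
open import Data.Bool.Properties using (T?)
open import Data.Fin using (Fin)
open import Data.Fin.Properties using (any?)
open import Data.Fin.Subset using (Subset; _∈_; _⊆_; Nonempty)
open import Data.Fin.Subset.Properties using (_∈?_)
open import Data.Integer using (+_)
open import Data.List using (List; length)
open import Data.List.Relation.Unary.All using (All)
open import Data.List.Relation.Unary.Unique.Propositional using (Unique)
import Data.List.Membership.Propositional as List
open import Data.Nat using (ℕ; zero; suc; _+_; _^_; _≤_)
open import Data.Product using (Σ; ∃; ∃-syntax; _×_)
open import Data.Rational as ℚ using (ℚ; _/_)
open import Data.Sum using (_⊎_)
open import Data.Vec using (Vec; []; _∷_; tabulate)
open import Function.Bundles using (_⇔_)
open import Relation.Binary.PropositionalEquality using (_≡_; _≢_)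
open import Relation.Nullary.Decidable using (does; _×-dec_)

record Graph (n : ℕ) : Set where
  field
    edge : Fin n → Fin n → Bool

  Edge : Fin n → Fin n → Set
  Edge u v = T (edge u v)

open Graph public

Pre : ∀ {n} → Graph n → Subset n → Subset n
Pre G S = tabulate λ v → does (any? λ s → (s ∈? S) ×-dec T? (edge G v s))

Post : ∀ {n} → Graph n → Subset n → Subset n
Post G S = tabulate λ v → does (any? λ s → (s ∈? S) ×-dec T? (edge G s v))

-- The natural number is the number of edges.
data Path {n} (G : Graph n) : ℕ → Fin n → Fin n → Set where
  []  : ∀ {u} → Path G 0 u u
  _∷_ : ∀ {k u v w} → Edge G u v → Path G k v w → Path G (suc k) u w

Reachable : ∀ {n} → Graph n → Fin n → Fin n → Set
Reachable G u v = ∃[ k ] Path G k u v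

-- Distance is a relation, since it is undefined on unreachable pairs.
IsDistance : ∀ {n} → Graph n → Fin n → Fin n → ℕ → Set
IsDistance G u v d = Path G d u v × (∀ k → Path G k u v → d ≤ k)

IsDiameter : ∀ {n} → Graph n → ℕ → Set
IsDiameter G D = (∃[ u ] ∃[ v ] IsDistance G u v D)
               × (∀ u v d → IsDistance G u v d → d ≤ D)

DiameterAtMost : ℕ → ∀ {n} → Graph n → Set
DiameterAtMost d₀ G = ∃[ D ] (IsDiameter G D × D ≤ d₀)

StronglyConnected : ∀ {n} → Graph n → Subset n → Set
StronglyConnected G C = ∀ u v → u ∈ C → v ∈ C → Reachable G u v

-- A single vertex is strongly connected, so trivial components count.
IsSCC : ∀ {n} → Graph n → Subset n → Set
IsSCC G C = Nonempty C × StronglyConnected G C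
          × (∀ D → StronglyConnected G D → C ⊆ D → D ⊆ C)

-- The list represents the set of its entries: order and repetitions are
-- irrelevant.
IsSetOfSCCs : ∀ {n} → Graph n → List (Subset n) → Set
IsSetOfSCCs G Cs = ∀ C → (C List.∈ Cs) ⇔ IsSCC G C

data Action (n : ℕ) (Out State : Set) : Set where
  halt : Out → Action n Out State
  pre  : Subset n → (Subset n → State) → Action n Out State
  post : Subset n → (Subset n → State) → Action n Out State
  toss : (Bool → State) → Action n Out State

-- A symbolic algorithm on vertex set Fin n.  The state type is arbitrary, so
-- it may store any number of sets, and computing the next action is
-- unrestricted and free; the graph is not an argument of step, so edges are
-- accessible only through the answers to pre and post.
record SymbolicAlgorithm (n : ℕ) (Out : Set) : Set₁ where
  field
    State : Set
    start : State
    step  : State → Action n Out State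

module Run {n} {Out : Set} (A : SymbolicAlgorithm n Out) (G : Graph n) where
  open SymbolicAlgorithm A

  after : State → Action n Out State → Bool → State
  after s (halt _)   _ = s
  after s (pre S k)  _ = k (Pre G S)
  after s (post S k) _ = k (Post G S)
  after s (toss k)   b = k b

  cost : Action n Out State → ℕ
  cost (halt _)   = 0
  cost (pre _ _)  = 1
  cost (post _ _) = 1
  cost (toss _)   = 0

  -- The i-th bit of a tape of length t is the coin of the i-th of t steps;
  -- steps that toss no coin discard their bit.
  stateAfter : State → ∀ {t} → Vec Bool t → State
  stateAfter s []      = s
  stateAfter s (b ∷ r) = stateAfter (after s (step s) b) r

  opsFrom : State → ∀ {t} → Vec Bool t → ℕ
  opsFrom s []      = 0
  opsFrom s (b ∷ r) = cost (step s) + opsFrom (after s (step s) b) r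

  oneStepOps : ∀ {t} → Vec Bool t → ℕ
  oneStepOps = opsFrom start

  HaltsWith : ∀ {t} → Vec Bool t → Out → Set
  HaltsWith r o = step (stateAfter start r) ≡ halt o

open Run public using (oneStepOps; HaltsWith)

Deterministic : ∀ {n Out} → SymbolicAlgorithm n Out → Set
Deterministic A = ∀ s k → step s ≢ toss k
  where open SymbolicAlgorithm A

ℕ→ℚ : ℕ → ℚ
ℕ→ℚ m = + m / 1

-- P has probability at least q for a uniformly random tape of length t:
-- it holds on at least q · 2^t pairwise distinct tapes.
ProbAtLeast : ℚ → ∀ {t} → (Vec Bool t → Set) → Set
ProbAtLeast q {t} P =
  Σ (List (Vec Bool t)) λ rs →
    Unique rs × All P rs × q ℚ.* ℕ→ℚ (2 ^ t) ℚ.≤ ℕ→ℚ (length rs)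

module _ {n Out} (A : SymbolicAlgorithm n Out)
         (Correct : Graph n → Out → Set) (G : Graph n) where

  CorrectOn : ∀ {t} → Vec Bool t → Set
  CorrectOn r = ∃[ o ] (HaltsWith A G r o × Correct G o)

  AlwaysCorrect : Set
  AlwaysCorrect = ∃[ t ] ∀ (r : Vec Bool t) → CorrectOn r

  -- The probability of halting correctly is the supremum over t of that of
  -- having done so within t steps; the supremum need not be attained, since
  -- the number of coin tosses may be unbounded and 2/3 is not dyadic.
  BoundedErrorCorrect : Set
  BoundedErrorCorrect =
    ∀ q → q ℚ.< + 2 / 3 → ∃[ t ] ProbAtLeast q {t} CorrectOn

-- One algorithm for each number of vertices, with no uniformity required.
module _ {Out : ℕ → Set} (A : ∀ n → SymbolicAlgorithm n (Out n))
         (Correct : ∀ {n} → Graph n → Out n → Set)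
         (Class : ∀ {n} → Graph n → Set) where

  DeterministicallySolves : Set
  DeterministicallySolves =
    (∀ n → Deterministic (A n)) ×
    (∀ n (G : Graph n) → Class G → AlwaysCorrect (A n) Correct G)

  ProbabilisticallySolves : Set
  ProbabilisticallySolves =
    ∀ n (G : Graph n) → Class G → BoundedErrorCorrect (A n) Correct G

  Solves : Set
  Solves = DeterministicallySolves ⊎ ProbabilisticallySolves

SCCAlgorithm : Set₁
SCCAlgorithm = ∀ n → SymbolicAlgorithm n (List (Subset n))

{-# OPTIONS --safe #-}

-- Let G₀ be the graph of the order 0 ≤ 1 ≤ … ≤ m on m + 1 vertices, and let
-- Gᵢ be G₀ with the back edge i+1 → i added.  The edge relation of each of
-- these graphs is a preorder, so all finite distances are at most 1, and the
-- components of Gᵢ differ from those of G₀.  A set S can have different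
-- predecessors in G₀ and Gᵢ only if max S = i, and different successors only if
-- min S = i+1; so each operation distinguishes G₀ from at most one Gᵢ.  An
-- algorithm that succeeds with probability at least 3/5 on both G₀ and Gᵢ must,
-- with probability at least 1/5, perform on G₀ an operation distinguishing the
-- two; summing over i, it performs on average at least m/5 operations on G₀.
module Submission where

open import Defs
open import Data.Bool using (Bool; true; false; if_then_else_)
open import Data.Bool.Properties as Bool using (T?)
open import Data.Fin as Fin using (Fin; zero; suc; toℕ; inject₁)
import Data.Fin.Properties as Fin
open import Data.Fin.Subset using (Subset; _∈_; _⊆_; ⁅_⁆; _∪_)
open import Data.Fin.Subset.Properties
  using (_∈?_; x∈⁅x⁆; x∈⁅y⁆⇒x≡y; x∈p∪q⁺; x∈p∪q⁻)
open import Data.Integer as ℤ using (+_)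
import Data.Integer.Properties as ℤ
open import Data.List using (List; []; _∷_; length)
open import Data.List.Relation.Unary.All using (All; []; _∷_)
open import Data.List.Relation.Unary.AllPairs using ([]; _∷_)
open import Data.List.Relation.Unary.Unique.Propositional using (Unique)
open import Data.Nat using (ℕ; zero; suc; _+_; _*_; _^_; _⊔_; _≤_; z≤n; s≤s; _≤?_)
open import Data.Nat.Properties
open import Data.Nat.Tactic.RingSolver using (solve-∀)
open import Data.Product using (Σ; ∃; ∃-syntax; _×_; _,_; proj₂)
open import Data.Rational as ℚ using (ℚ; 0ℚ)
import Data.Rational.Properties as ℚ
open import Data.Rational.Unnormalised as ℚᵘ using (mkℚᵘ; *≤*)
import Data.Rational.Unnormalised.Properties as ℚᵘ
open import Data.Sum using (_⊎_; inj₁; inj₂)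
open import Data.Vec using (Vec; []; _∷_; take)
open import Data.Vec.Properties using (≡-dec; tabulate-cong)
open import Function using (_∘_; const)
open import Function.Bundles using (_⇔_; mk⇔; Equivalence)
open import Level using (0ℓ)
open import Relation.Binary using (Rel; Decidable; Reflexive; Transitive)
open import Relation.Binary.PropositionalEquality
  using (_≡_; _≢_; refl; sym; trans; cong; cong₂; subst)
open import Relation.Nullary using (¬_; yes; no; contradiction)
open import Relation.Nullary.Decidable
  using (does; isYes; does-⇔; toWitness; fromWitness; _×-dec_; _⊎-dec_)

open import Algebra.Properties.CommutativeMonoid.Sum +-0-commutativeMonoid
  using (sum; ∑-distrib-+; sum-cong-≗; sum-replicate-zero)

-- 0-1 weights and their finite sums.

-- One-sided on purpose: the weight 1 carries a proof of `P`, while 0 claims nothing. Correctness of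
-- a run can thus be counted from below without being decided.
Certifies : Set → ℕ → Set
Certifies P k = k ≡ 0 ⊎ (k ≡ 1 × P)

sum-zero : ∀ {m} (f : Fin m → ℕ) → (∀ i → f i ≡ 0) → sum f ≡ 0
sum-zero {m} f f≡0 = trans (sum-cong-≗ f≡0) (sum-replicate-zero m)

-- Two indices of weight 1 would both satisfy `R` and hence coincide. This is the numerical form of
-- "an operation distinguishes at most one graph".
sum-≤1 : ∀ {m} (f : Fin m → ℕ) {R : Fin m → Set} →
         (∀ i → Certifies (R i) (f i)) → (∀ {i j} → R i → R j → i ≡ j) → sum f ≤ 1
sum-≤1 {zero}  f cert unique = z≤n
sum-≤1 {suc m} f cert unique with cert zero
... | inj₁ f0≡0 rewrite f0≡0 =
  sum-≤1 (f ∘ suc) (cert ∘ suc) λ r r′ → Fin.suc-injective (unique r r′)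
... | inj₂ (f0≡1 , r) = ≤-reflexive (cong₂ _+_ f0≡1 (sum-zero (f ∘ suc) others))
  where
  others : ∀ i → f (suc i) ≡ 0
  others i with cert (suc i)
  ... | inj₁ f≡0      = f≡0
  ... | inj₂ (_ , r′) with () ← unique r r′

-- Sums over tapes

-- This is `2 ^ t` times the expectation over uniform tapes, so probabilistic estimates become
-- inequalities in `ℕ`.
sumTapes : ∀ {t} → (Vec Bool t → ℕ) → ℕ
sumTapes {zero}  f = f []
sumTapes {suc t} f = sumTapes (f ∘ (true ∷_)) + sumTapes (f ∘ (false ∷_))

sumTapes-mono : ∀ {t} {f g : Vec Bool t → ℕ} → (∀ r → f r ≤ g r) → sumTapes f ≤ sumTapes g
sumTapes-mono {zero}  f≤g = f≤g []
sumTapes-mono {suc t} f≤g =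
  +-mono-≤ (sumTapes-mono (f≤g ∘ (true ∷_))) (sumTapes-mono (f≤g ∘ (false ∷_)))

double : ∀ a b → a * b + a * b ≡ a * (2 * b)
double = solve-∀

sumTapes-const : ∀ t k → sumTapes {t} (const k) ≡ k * 2 ^ t
sumTapes-const zero    k = sym (*-identityʳ k)
sumTapes-const (suc t) k rewrite sumTapes-const t k = double k (2 ^ t)

sumTapes-one : ∀ t → sumTapes {t} (const 1) ≡ 2 ^ t
sumTapes-one t = trans (sumTapes-const t 1) (*-identityˡ (2 ^ t))

+-interchange : ∀ a b c d → (a + b) + (c + d) ≡ (a + c) + (b + d)
+-interchange = solve-∀

sumTapes-+ : ∀ {t} (f g : Vec Bool t → ℕ) →
             sumTapes (λ r → f r + g r) ≡ sumTapes f + sumTapes g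
sumTapes-+ {zero}  f g = refl
sumTapes-+ {suc t} f g = trans
  (cong₂ _+_ (sumTapes-+ (f ∘ (true ∷_)) (g ∘ (true ∷_)))
             (sumTapes-+ (f ∘ (false ∷_)) (g ∘ (false ∷_))))
  (+-interchange (sumTapes (f ∘ (true ∷_))) (sumTapes (g ∘ (true ∷_))) _ _)

-- Each tape of length `t` has `2 ^ s` extensions to length `t + s`.
sumTapes-take : ∀ t s (f : Vec Bool t → ℕ) →
                sumTapes {t + s} (f ∘ take t) ≡ sumTapes f * 2 ^ s
sumTapes-take zero    s f = sumTapes-const s (f [])
sumTapes-take (suc t) s f
  rewrite sumTapes-take t s (f ∘ (true ∷_)) | sumTapes-take t s (f ∘ (false ∷_)) =
  sym (*-distribʳ-+ (2 ^ s) (sumTapes (f ∘ (true ∷_))) _)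

-- Linearity of expectation: the bounds for the single `i` add up to a bound for the sum taken tape
-- by tape.
sumTapes-sum : ∀ {m t} c K (f : Fin m → Vec Bool t → ℕ) →
               (∀ i → K ≤ c * sumTapes (f i)) →
               m * K ≤ c * sumTapes (λ r → sum λ i → f i r)
sumTapes-sum {zero}  c K f K≤ = z≤n
sumTapes-sum {suc m} c K f K≤
  rewrite sumTapes-+ (f zero) (λ r → sum λ i → f (suc i) r)
        | *-distribˡ-+ c (sumTapes (f zero)) (sumTapes λ r → sum λ i → f (suc i) r) =
  +-mono-≤ (K≤ zero) (sumTapes-sum c K (f ∘ suc) (K≤ ∘ suc))

-- Some tape reaches the average. The search descends into a half whose average is large enough; if
-- both halves fell short, so would their sum.
pigeonhole : ∀ {t} c m (f : Vec Bool t → ℕ) →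
             m * 2 ^ t ≤ c * sumTapes f → ∃[ r ] m ≤ c * f r
pigeonhole {zero}  c m f le = [] , subst (_≤ c * f []) (*-identityʳ m) le
pigeonhole {suc t} c m f le with m * 2 ^ t ≤? c * sumTapes (f ∘ (true ∷_))
... | yes p = let r , q = pigeonhole c m (f ∘ (true ∷_)) p in true ∷ r , q
... | no ¬p with m * 2 ^ t ≤? c * sumTapes (f ∘ (false ∷_))
...   | yes p = let r , q = pigeonhole c m (f ∘ (false ∷_)) p in false ∷ r , q
...   | no ¬q = contradiction le (<⇒≱ (begin-strict
  c * (F + F′)           ≡⟨ *-distribˡ-+ c F F′ ⟩
  c * F + c * F′         <⟨ +-mono-< (≰⇒> ¬p) (≰⇒> ¬q) ⟩
  m * 2 ^ t + m * 2 ^ t  ≡⟨ double m (2 ^ t) ⟩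
  m * (2 * 2 ^ t)        ∎))
  where
  open ≤-Reasoning
  F F′ : ℕ
  F  = sumTapes (f ∘ (true ∷_))
  F′ = sumTapes (f ∘ (false ∷_))

-- Lists of distinct tapes as 0-1 weights.

δ : ∀ {t} → Vec Bool t → Vec Bool t → ℕ
δ x r = if does (≡-dec Bool._≟_ x r) then 1 else 0

sumTapes-δ : ∀ {t} (x : Vec Bool t) → sumTapes (δ x) ≡ 1
sumTapes-δ []                  = refl
sumTapes-δ {suc t} (true ∷ x)  =
  cong₂ _+_ (sumTapes-δ x) (sumTapes-const t 0)
sumTapes-δ {suc t} (false ∷ x) =
  cong₂ _+_ (sumTapes-const t 0) (sumTapes-δ x)

multiplicity : ∀ {t} → List (Vec Bool t) → Vec Bool t → ℕ
multiplicity []       r = 0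
multiplicity (x ∷ xs) r = δ x r + multiplicity xs r

sumTapes-multiplicity : ∀ {t} (xs : List (Vec Bool t)) → sumTapes (multiplicity xs) ≡ length xs
sumTapes-multiplicity {t} []   = sumTapes-const t 0
sumTapes-multiplicity (x ∷ xs) = trans (sumTapes-+ (δ x) (multiplicity xs))
  (cong₂ _+_ (sumTapes-δ x) (sumTapes-multiplicity xs))

multiplicity-∉ : ∀ {t} {x : Vec Bool t} {xs} → All (x ≢_) xs → multiplicity xs x ≡ 0
multiplicity-∉ []                             = refl
multiplicity-∉ {x = x} {y ∷ _} (x≢y ∷ x≢xs) with ≡-dec Bool._≟_ y x
... | yes y≡x = contradiction (sym y≡x) x≢y
... | no  _   = multiplicity-∉ x≢xs

-- Without repetitions, the multiplicity is the indicator function of the list. With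
-- `sumTapes-multiplicity`, this turns the list witnessing `ProbAtLeast` into a certified weight
-- with total the length of the list.
multiplicity-certifies : ∀ {t} {P : Vec Bool t → Set} {xs} → Unique xs → All P xs →
                         ∀ r → Certifies (P r) (multiplicity xs r)
multiplicity-certifies []         []         r = inj₁ refl
multiplicity-certifies {xs = x ∷ _} (x∉xs ∷ u) (px ∷ pxs) r with ≡-dec Bool._≟_ x r
... | yes refl = inj₂ (cong suc (multiplicity-∉ x∉xs) , px)
... | no  _    = multiplicity-certifies u pxs r

-- Rational bounds as inequalities of natural numbers

module _ (a b m k : ℕ) where

  private
    -- Normalised fractions with variable entries do not compute because of the gcd; in unnormalised
    -- form, comparison is plain cross-multiplication.
    scaled : ℚ.toℚᵘ ((+ a ℚ./ suc b) ℚ.* ℕ→ℚ m) ℚᵘ.≃ mkℚᵘ (+ a) b ℚᵘ.* mkℚᵘ (+ m) 0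
    scaled = ℚᵘ.≃-trans (ℚ.toℚᵘ-homo-* (+ a ℚ./ suc b) (ℕ→ℚ m))
      (ℚᵘ.*-cong (ℚ.toℚᵘ-fromℚᵘ (mkℚᵘ (+ a) b)) (ℚ.toℚᵘ-fromℚᵘ (mkℚᵘ (+ m) 0)))

    natural : ℚ.toℚᵘ (ℕ→ℚ k) ℚᵘ.≃ mkℚᵘ (+ k) 0
    natural = ℚ.toℚᵘ-fromℚᵘ (mkℚᵘ (+ k) 0)

    numerators : (+ a ℤ.* + m) ℤ.* + 1 ≡ + (a * m)
    numerators = trans (ℤ.*-identityʳ _) (sym (ℤ.pos-* a m))

    denominators : + k ℤ.* + suc (b * 1) ≡ + (suc b * k)
    denominators rewrite *-identityʳ b =
      trans (sym (ℤ.pos-* k (suc b))) (cong +_ (*-comm k (suc b)))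

  ℚ-bound⁻ : (+ a ℚ./ suc b) ℚ.* ℕ→ℚ m ℚ.≤ ℕ→ℚ k → a * m ≤ suc b * k
  ℚ-bound⁻ le with ℚᵘ.≤-respˡ-≃ scaled (ℚᵘ.≤-respʳ-≃ natural (ℚ.toℚᵘ-mono-≤ le))
  ... | *≤* le′ rewrite numerators | denominators = ℤ.drop‿+≤+ le′

  ℚ-bound⁺ : a * m ≤ suc b * k → (+ a ℚ./ suc b) ℚ.* ℕ→ℚ m ℚ.≤ ℕ→ℚ k
  ℚ-bound⁺ le = ℚ.toℚᵘ-cancel-≤
    (ℚᵘ.≤-respˡ-≃ (ℚᵘ.≃-sym scaled) (ℚᵘ.≤-respʳ-≃ (ℚᵘ.≃-sym natural) (*≤* le′)))
    where
    le′ : (+ a ℤ.* + m) ℤ.* + 1 ℤ.≤ + k ℤ.* + suc (b * 1)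
    le′ rewrite numerators | denominators = ℤ.+≤+ le

-- Runs on two graphs

Pre-cong : ∀ {n} (G G′ : Graph n) S →
           (∀ v → (∃[ s ] (s ∈ S × Edge G v s)) ⇔ (∃[ s ] (s ∈ S × Edge G′ v s))) →
           Pre G S ≡ Pre G′ S
Pre-cong G G′ S iff = tabulate-cong λ v → does-⇔ (iff v)
  (Fin.any? λ s → (s ∈? S) ×-dec T? (edge G v s))
  (Fin.any? λ s → (s ∈? S) ×-dec T? (edge G′ v s))

Post-cong : ∀ {n} (G G′ : Graph n) S →
            (∀ v → (∃[ s ] (s ∈ S × Edge G s v)) ⇔ (∃[ s ] (s ∈ S × Edge G′ s v))) →
            Post G S ≡ Post G′ S
Post-cong G G′ = Pre-cong (reverse G) (reverse G′)
  where
  reverse : ∀ {n} → Graph n → Graph n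
  reverse G = record { edge = λ u v → edge G v u }

differs : ∀ {n} → Subset n → Subset n → ℕ
differs S S′ = if does (≡-dec Bool._≟_ S S′) then 0 else 1

differs-certifies : ∀ {n} {S S′ : Subset n} {P : Set} → S ≡ S′ ⊎ P → Certifies P (differs S S′)
differs-certifies {S = S} {S′} dich with ≡-dec Bool._≟_ S S′ | dich
... | yes _   | _         = inj₁ refl
... | no S≢S′ | inj₁ S≡S′ = contradiction S≡S′ S≢S′
... | no _    | inj₂ p    = inj₂ (refl , p)

differs≡0 : ∀ {n} {S S′ : Subset n} → differs S S′ ≡ 0 → S ≡ S′
differs≡0 {S = S} {S′} eq with ≡-dec Bool._≟_ S S′
... | yes S≡S′ = S≡S′
differs≡0 {S = S} {S′} () | no _

-- `R i` is a condition that must hold whenever `op` on `S` tells `G` from `Gs i`. It is left open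
-- because `Pre` and `Post` need different conditions, one on the maximum and one on the minimum of
-- `S`.
Separated : ∀ {m n} → Graph n → (Fin m → Graph n) → (Graph n → Subset n → Subset n) → Set₁
Separated {m} G Gs op = ∀ S → Σ (Fin m → Set) λ R →
  (∀ i → op G S ≡ op (Gs i) S ⊎ R i) × (∀ {i j} → R i → R j → i ≡ j)

module _ {n} {Out : Set} (A : SymbolicAlgorithm n Out) where
  open SymbolicAlgorithm A

  halt-stable : ∀ (G : Graph n) s {o t} (r : Vec Bool t) →
                step s ≡ halt o → step (Run.stateAfter A G s r) ≡ halt o
  halt-stable G s []      eq = eq
  halt-stable G s (b ∷ r) eq rewrite eq = halt-stable G s r eq

  halt-take : ∀ (G : Graph n) s {o} t {k} (r : Vec Bool (t + k)) →
              step (Run.stateAfter A G s (take t r)) ≡ halt o →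
              step (Run.stateAfter A G s r) ≡ halt o
  halt-take G s zero    r       eq = halt-stable G s r eq
  halt-take G s (suc t) (b ∷ r) eq = halt-take G _ t r eq

  module _ (Correct : Graph n → Out → Set) (G : Graph n) where

    -- Probability 3/5 lies below 2/3, so bounded error provides it within some finite time although
    -- 2/3 itself need not be attained. It exceeds 1/2, so the successful tapes of two graphs
    -- overlap, in a fraction of at least 1/5.
    Succeeds : ℕ → Set
    Succeeds t = Σ (Vec Bool t → ℕ) λ w →
      (∀ r → Certifies (CorrectOn A Correct G r) (w r)) × 3 * 2 ^ t ≤ 5 * sumTapes w

    -- A halted run keeps its output, so a success is decided by the first `t` bits. This allows
    -- different graphs to be compared on tapes of one common length.
    succeeds-mono : ∀ {t t′} → t ≤ t′ → Succeeds t → Succeeds t′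
    succeeds-mono {t} t≤t′ (w , cert , bound)
      with k , refl ← m≤n⇒∃[o]m+o≡n t≤t′ = w ∘ take t , cert′ , bound′
      where
      cert′ : ∀ r → Certifies (CorrectOn A Correct G r) (w (take t r))
      cert′ r with cert (take t r)
      ... | inj₁ w≡0                = inj₁ w≡0
      ... | inj₂ (w≡1 , o , h , c)  = inj₂ (w≡1 , o , halt-take G start t r h , c)

      bound′ : 3 * 2 ^ (t + k) ≤ 5 * sumTapes {t + k} (w ∘ take t)
      bound′ = begin
        3 * 2 ^ (t + k)                ≡⟨ cong (3 *_) (^-distribˡ-+-* 2 t k) ⟩
        3 * (2 ^ t * 2 ^ k)            ≡⟨ *-assoc 3 (2 ^ t) (2 ^ k) ⟨
        3 * 2 ^ t * 2 ^ k              ≤⟨ *-monoˡ-≤ (2 ^ k) bound ⟩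
        5 * sumTapes w * 2 ^ k         ≡⟨ *-assoc 5 (sumTapes w) (2 ^ k) ⟩
        5 * (sumTapes w * 2 ^ k)       ≡⟨ cong (5 *_) (sumTapes-take t k w) ⟨
        5 * sumTapes {t + k} (w ∘ take t) ∎
        where open ≤-Reasoning

    alwaysCorrect⇒succeeds : AlwaysCorrect A Correct G → ∃ Succeeds
    alwaysCorrect⇒succeeds (t , correct) =
      t , const 1 , (λ r → inj₂ (refl , correct r)) ,
      subst (λ k → 3 * 2 ^ t ≤ 5 * k) (sym (sumTapes-one t)) (*-monoˡ-≤ (2 ^ t) (m≤m+n 3 2))

    boundedError⇒succeeds : BoundedErrorCorrect A Correct G → ∃ Succeeds
    boundedError⇒succeeds correct
      with t , rs , unique , all , bound ← correct (+ 3 ℚ./ 5) (toWitness {a? = _ ℚ.<? _} _) =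
      t , multiplicity rs , multiplicity-certifies unique all ,
      subst (λ l → 3 * 2 ^ t ≤ 5 * l) (sym (sumTapes-multiplicity rs))
        (ℚ-bound⁻ 3 4 (2 ^ t) (length rs) bound)

  module _ (G G′ : Graph n) where

    distinguishing : Action n Out State → ℕ
    distinguishing (halt _)   = 0
    distinguishing (pre S _)  = differs (Pre G S) (Pre G′ S)
    distinguishing (post S _) = differs (Post G S) (Post G′ S)
    distinguishing (toss _)   = 0

    -- The steps are those of the run on G.
    distinguishingOps : State → ∀ {t} → Vec Bool t → ℕ
    distinguishingOps s []      = 0
    distinguishingOps s (b ∷ r) =
      distinguishing (step s) + distinguishingOps (Run.after A G s (step s) b) r

    after-agrees : ∀ s a b → distinguishing a ≡ 0 → Run.after A G s a b ≡ Run.after A G′ s a b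
    after-agrees s (halt _)   b eq = refl
    after-agrees s (pre S k)  b eq = cong k (differs≡0 eq)
    after-agrees s (post S k) b eq = cong k (differs≡0 eq)
    after-agrees s (toss _)   b eq = refl

    -- As long as every answer is the same on both graphs, equal coins lead to equal states, so the
    -- next operation is also the same. Tracking the run on `G` alone therefore suffices.
    stateAfter-agrees : ∀ s {t} (r : Vec Bool t) → distinguishingOps s r ≡ 0 →
                        Run.stateAfter A G s r ≡ Run.stateAfter A G′ s r
    stateAfter-agrees s []      eq = refl
    stateAfter-agrees s (b ∷ r) eq = trans
      (stateAfter-agrees (Run.after A G s (step s) b) r (m+n≡0⇒n≡0 (distinguishing (step s)) eq))
      (cong (λ s′ → Run.stateAfter A G′ s′ r)
        (after-agrees s (step s) b (m+n≡0⇒m≡0 (distinguishing (step s)) eq)))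

    module _ (Correct : Graph n → Out → Set)
             (incompatible : ∀ o → Correct G o → ¬ Correct G′ o) where

      -- Otherwise both runs would end in the same state and halt with the same output, which cannot
      -- be correct for both graphs.
      correctOnBoth⇒distinguished : ∀ {t} (r : Vec Bool t) →
        CorrectOn A Correct G r → CorrectOn A Correct G′ r → 1 ≤ distinguishingOps start r
      correctOnBoth⇒distinguished r (o , h , c) (o′ , h′ , c′) = n≢0⇒n>0 λ eq →
        let same = trans (sym h) (trans (cong step (stateAfter-agrees start r eq)) h′)
        in incompatible o c (subst (Correct G′) (sym (halt-injective same)) c′)
        where
        halt-injective : ∀ {o o′} → halt {n} {Out} {State} o ≡ halt o′ → o ≡ o′
        halt-injective refl = refl

      -- With W and W′ the numbers of successful tapes on G and G′:
      -- 6/5 · 2^t ≤ W + W′ ≤ 2^t + (number of distinguishing operations).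
      distinguishingOps-bound : ∀ {t} → Succeeds Correct G t → Succeeds Correct G′ t →
        2 ^ t ≤ 5 * sumTapes (λ (r : Vec Bool t) → distinguishingOps start r)
      distinguishingOps-bound {t} (w , cert , bound) (w′ , cert′ , bound′) =
        +-cancelˡ-≤ (5 * 2 ^ t) (2 ^ t) (5 * H) (begin
          5 * 2 ^ t + 2 ^ t              ≡⟨ split (2 ^ t) ⟩
          3 * 2 ^ t + 3 * 2 ^ t          ≤⟨ +-mono-≤ bound bound′ ⟩
          5 * sumTapes w + 5 * sumTapes w′ ≡⟨ *-distribˡ-+ 5 (sumTapes w) (sumTapes w′) ⟨
          5 * (sumTapes w + sumTapes w′) ≡⟨ cong (5 *_) (sumTapes-+ w w′) ⟨
          5 * sumTapes (λ r → w r + w′ r) ≤⟨ *-monoʳ-≤ 5 (sumTapes-mono pointwise) ⟩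
          5 * sumTapes {t} (λ r → 1 + distinguishingOps start r)
            ≡⟨ cong (5 *_) (sumTapes-+ {t} (const 1) (distinguishingOps start)) ⟩
          5 * (sumTapes {t} (const 1) + H) ≡⟨ cong (λ k → 5 * (k + H)) (sumTapes-one t) ⟩
          5 * (2 ^ t + H)                ≡⟨ *-distribˡ-+ 5 (2 ^ t) H ⟩
          5 * 2 ^ t + 5 * H              ∎)
        where
        open ≤-Reasoning hiding (start)
        H : ℕ
        H = sumTapes (λ (r : Vec Bool t) → distinguishingOps start r)

        split : ∀ a → 5 * a + a ≡ 3 * a + 3 * a
        split = solve-∀

        pointwise : ∀ r → w r + w′ r ≤ 1 + distinguishingOps start r
        pointwise r with cert r | cert′ r
        ... | inj₁ w≡0       | inj₁ w′≡0        rewrite w≡0 | w′≡0 = z≤n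
        ... | inj₁ w≡0       | inj₂ (w′≡1 , _)  rewrite w≡0 | w′≡1 = s≤s z≤n
        ... | inj₂ (w≡1 , _) | inj₁ w′≡0        rewrite w≡1 | w′≡0 = s≤s z≤n
        ... | inj₂ (w≡1 , c) | inj₂ (w′≡1 , c′) rewrite w≡1 | w′≡1 =
          s≤s (correctOnBoth⇒distinguished r c c′)

  module _ {m} (G : Graph n) (Gs : Fin m → Graph n)
           (pre-separated : Separated G Gs Pre) (post-separated : Separated G Gs Post) where

    -- A one-step operation costs 1 and, by separation, contributes to at most one summand; halting
    -- and tossing contribute to none.
    sum-distinguishing : ∀ a → sum (λ i → distinguishing G (Gs i) a) ≤ Run.cost A G a
    sum-distinguishing (halt _)   = ≤-reflexive (sum-zero {m} _ λ _ → refl)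
    sum-distinguishing (pre S _)  = let R , dich , unique = pre-separated S in
      sum-≤1 _ (λ i → differs-certifies (dich i)) unique
    sum-distinguishing (post S _) = let R , dich , unique = post-separated S in
      sum-≤1 _ (λ i → differs-certifies (dich i)) unique
    sum-distinguishing (toss _)   = ≤-reflexive (sum-zero {m} _ λ _ → refl)

    sum-distinguishingOps : ∀ s {t} (r : Vec Bool t) →
      sum (λ i → distinguishingOps G (Gs i) s r) ≤ Run.opsFrom A G s r
    sum-distinguishingOps s []      = ≤-reflexive (sum-zero {m} _ λ _ → refl)
    sum-distinguishingOps s (b ∷ r) = ≤-trans
      (≤-reflexive (∑-distrib-+ (λ i → distinguishing G (Gs i) (step s)) _))
      (+-mono-≤ (sum-distinguishing (step s)) (sum-distinguishingOps _ r))

    module _ (Correct : Graph n → Out → Set)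
             (incompatible : ∀ i o → Correct G o → ¬ Correct (Gs i) o) where

      manyOps : ∃ (Succeeds Correct G) → (∀ i → ∃ (Succeeds Correct (Gs i))) →
                ∃[ t ] Σ (Vec Bool t) λ r → m ≤ 5 * oneStepOps A G r
      manyOps (t₀ , success₀) successes =
        -- Each graph comes with its own time bound; as there are finitely many, a maximum serves
        -- them all.
        let T , success = uniform (λ i → Succeeds Correct (Gs i))
                            (λ i → succeeds-mono Correct (Gs i)) successes
            t           = t₀ ⊔ T
            ops         = λ i (r : Vec Bool t) → distinguishingOps G (Gs i) start r
            each        = λ i → distinguishingOps-bound G (Gs i) Correct (incompatible i)
                            (succeeds-mono Correct G (m≤m⊔n t₀ T) success₀)
                            (succeeds-mono Correct (Gs i) (m≤n⊔m t₀ T) (success i))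
            -- Every `i` accounts for at least 1/5 distinguishing operation on average, so the
            -- average total is at least m/5, and some tape reaches it.
            r , m≤      = pigeonhole 5 m (λ r → sum λ i → ops i r)
                            (sumTapes-sum 5 (2 ^ t) ops each)
        in t , r , ≤-trans m≤ (*-monoʳ-≤ 5 (sum-distinguishingOps start r))
        where
        uniform : ∀ {k} (P : Fin k → ℕ → Set) → (∀ i {t t′} → t ≤ t′ → P i t → P i t′) →
                  (∀ i → ∃ (P i)) → ∃[ T ] ∀ i → P i T
        uniform {zero}  P mono ex = 0 , λ ()
        uniform {suc k} P mono ex =
          let t , p  = ex zero
              T , ps = uniform (P ∘ suc) (mono ∘ suc) (ex ∘ suc)
          in t ⊔ T , λ { zero    → mono zero (m≤m⊔n t T) p
                       ; (suc i) → mono (suc i) (m≤n⊔m t T) (ps i) }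

-- Graphs of preorders

module _ {n} {R : Rel (Fin n) 0ℓ} (R? : Decidable R) where

  graphOf : Graph n
  graphOf = record { edge = λ u v → isYes (R? u v) }

  module _ (R-refl : Reflexive R) (R-trans : Transitive R) where

    -- In the graph of a preorder, reachability collapses to a single edge; hence the diameter
    -- bound.
    path⇒R : ∀ {k u v} → Path graphOf k u v → R u v
    path⇒R []      = R-refl
    path⇒R (e ∷ p) = R-trans (toWitness e) (path⇒R p)

    R⇒path : ∀ {u v} → R u v → Path graphOf 1 u v
    R⇒path uRv = fromWitness uRv ∷ []

    distance≤1 : ∀ u v d → IsDistance graphOf u v d → d ≤ 1
    distance≤1 u v d (p , minimal) = minimal 1 (R⇒path (path⇒R p))

    -- `IsDiameter` requires the maximum to be attained; two distinct related vertices attain 1.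
    diameter≤1 : ∀ {u v} → R u v → u ≢ v → DiameterAtMost 1 graphOf
    diameter≤1 {u} {v} uRv u≢v =
      1 , ((u , v , R⇒path uRv , minimal) , distance≤1) , ≤-refl
      where
      minimal : ∀ k → Path graphOf k u v → 1 ≤ k
      minimal zero    [] = contradiction refl u≢v
      minimal (suc k) _  = s≤s z≤n

    -- Mutually reachable vertices are related both ways, hence equal by antisymmetry.
    ⁅x⁆-SCC : (∀ {u v} → R u v → R v u → u ≡ v) → ∀ x → IsSCC graphOf ⁅ x ⁆
    ⁅x⁆-SCC antisym x = (x , x∈⁅x⁆ x) , connected , maximal
      where
      connected : StronglyConnected graphOf ⁅ x ⁆
      connected u v u∈ v∈
        with refl ← x∈⁅y⁆⇒x≡y x u∈ | refl ← x∈⁅y⁆⇒x≡y x v∈ = 0 , []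

      maximal : ∀ D → StronglyConnected graphOf D → ⁅ x ⁆ ⊆ D → D ⊆ ⁅ x ⁆
      maximal D conn x⊆D {y} y∈D
        with refl ← antisym (path⇒R (proj₂ (conn x y (x⊆D (x∈⁅x⁆ x)) y∈D)))
                            (path⇒R (proj₂ (conn y x y∈D (x⊆D (x∈⁅x⁆ x))))) = x∈⁅x⁆ x

    -- Adding `y` keeps the singleton strongly connected, so it is not maximal.
    ⁅x⁆-not-SCC : ∀ {x y} → x ≢ y → R x y → R y x → ¬ IsSCC graphOf ⁅ x ⁆
    ⁅x⁆-not-SCC {x} {y} x≢y xRy yRx (_ , _ , maximal) =
      x≢y (sym (x∈⁅y⁆⇒x≡y x (maximal (⁅ x ⁆ ∪ ⁅ y ⁆) connected
        (λ u∈ → x∈p∪q⁺ (inj₁ u∈)) (x∈p∪q⁺ (inj₂ (x∈⁅x⁆ y))))))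
      where
      member : ∀ {u} → u ∈ ⁅ x ⁆ ∪ ⁅ y ⁆ → u ≡ x ⊎ u ≡ y
      member u∈ with x∈p∪q⁻ ⁅ x ⁆ ⁅ y ⁆ u∈
      ... | inj₁ u∈x = inj₁ (x∈⁅y⁆⇒x≡y x u∈x)
      ... | inj₂ u∈y = inj₂ (x∈⁅y⁆⇒x≡y y u∈y)

      connected : StronglyConnected graphOf (⁅ x ⁆ ∪ ⁅ y ⁆)
      connected u v u∈ v∈ with member u∈ | member v∈
      ... | inj₁ refl | inj₁ refl = 0 , []
      ... | inj₁ refl | inj₂ refl = 1 , R⇒path xRy
      ... | inj₂ refl | inj₁ refl = 1 , R⇒path yRx
      ... | inj₂ refl | inj₂ refl = 0 , []

-- The chain and its back edges

module _ {m : ℕ} where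

  inject₁<suc : (i : Fin m) → inject₁ i Fin.< Fin.suc i
  inject₁<suc i = Fin.≤̄⇒inject₁< (Fin.≤-refl {x = i})

  inject₁<⇒suc≤ : ∀ (i : Fin m) {u : Fin (suc m)} → inject₁ i Fin.< u → Fin.suc i Fin.≤ u
  inject₁<⇒suc≤ i {u} = subst (λ k → suc k ≤ toℕ u) (Fin.toℕ-inject₁ i)

  <suc⇒≤inject₁ : ∀ (i : Fin m) {u : Fin (suc m)} → u Fin.< Fin.suc i → u Fin.≤ inject₁ i
  <suc⇒≤inject₁ i {u} (s≤s u≤i) = subst (toℕ u ≤_) (sym (Fin.toℕ-inject₁ i)) u≤i

  Linked : Fin m → Rel (Fin (suc m)) 0ℓ
  Linked i u v = u Fin.≤ v ⊎ (u ≡ suc i × v ≡ inject₁ i)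

  linked? : ∀ i → Decidable (Linked i)
  linked? i u v = (u Fin.≤? v) ⊎-dec ((u Fin.≟ suc i) ×-dec (v Fin.≟ inject₁ i))

  linked-refl : ∀ i → Reflexive (Linked i)
  linked-refl i = inj₁ Fin.≤-refl

  -- No vertex lies strictly between `inject₁ i` and `suc i`. Hence a strict step up, composed with
  -- the back edge on either side, is again a step of the order, and a non-strict one is an
  -- equality. Two back edges do not compose.
  linked-trans : ∀ i → Transitive (Linked i)
  linked-trans i (inj₁ u≤v) (inj₁ v≤w) = inj₁ (Fin.≤-trans u≤v v≤w)
  linked-trans i (inj₁ u≤v) (inj₂ (refl , refl)) with m≤n⇒m<n∨m≡n u≤v
  ... | inj₁ u<v = inj₁ (<suc⇒≤inject₁ i u<v)
  ... | inj₂ u≡v = inj₂ (Fin.toℕ-injective u≡v , refl)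
  linked-trans i (inj₂ (refl , refl)) (inj₁ v≤w) with m≤n⇒m<n∨m≡n v≤w
  ... | inj₁ v<w = inj₁ (inject₁<⇒suc≤ i v<w)
  ... | inj₂ v≡w = inj₂ (refl , sym (Fin.toℕ-injective v≡w))
  linked-trans i (inj₂ (refl , refl)) (inj₂ (eq , _)) =
    contradiction eq (Fin.<⇒≢ (inject₁<suc i))

  chain : Graph (suc m)
  chain = graphOf Fin._≤?_

  chainWithBackEdge : Fin m → Graph (suc m)
  chainWithBackEdge i = graphOf (linked? i)

  -- The singleton of `inject₁ i` is a component of the chain, but the back edge merges it with
  -- `suc i`.
  backEdge-incompatible : ∀ i Cs → IsSetOfSCCs chain Cs → ¬ IsSetOfSCCs (chainWithBackEdge i) Cs
  backEdge-incompatible i Cs chainSCCs backSCCs =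
    ⁅x⁆-not-SCC (linked? i) (linked-refl i) (linked-trans i) {inject₁ i} {suc i}
      (Fin.<⇒≢ (inject₁<suc i)) (inj₁ (<⇒≤ (inject₁<suc i))) (inj₂ (refl , refl))
      (Equivalence.to (backSCCs _) (Equivalence.from (chainSCCs _)
        (⁅x⁆-SCC Fin._≤?_ Fin.≤-refl Fin.≤-trans Fin.≤-antisym (inject₁ i))))

  IsMax IsMin : Subset (suc m) → Fin (suc m) → Set
  IsMax S x = x ∈ S × (∀ y → y ∈ S → y Fin.≤ x)
  IsMin S x = x ∈ S × (∀ y → y ∈ S → x Fin.≤ y)

  -- The back edge can only add `suc i` to the predecessors, and only if `inject₁ i` is in `S`. An
  -- element of `S` at or above `suc i` already makes it a predecessor in the chain.
  pre-agrees : ∀ S i → (inject₁ i ∈ S → ∃[ s ] (s ∈ S × Fin.suc i Fin.≤ s)) →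
               Pre chain S ≡ Pre (chainWithBackEdge i) S
  pre-agrees S i above = Pre-cong chain (chainWithBackEdge i) S λ v →
    mk⇔ (λ (s , s∈S , e) → s , s∈S , fromWitness (inj₁ (toWitness e)))
        (λ (s , s∈S , e) → back v s s∈S (toWitness e))
    where
    back : ∀ v s → s ∈ S → Linked i v s → ∃[ s ] (s ∈ S × Edge chain v s)
    back v s s∈S (inj₁ v≤s)           = s , s∈S , fromWitness v≤s
    back v s s∈S (inj₂ (refl , refl)) =
      let s′ , s′∈S , i<s′ = above s∈S in s′ , s′∈S , fromWitness i<s′

  -- If `inject₁ i` is not the maximum of `S`, it is missing from `S` or has a larger element of `S`
  -- above it; either way `pre-agrees` applies.
  pre-dichotomy : ∀ S i → Pre chain S ≡ Pre (chainWithBackEdge i) S ⊎ IsMax S (inject₁ i)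
  pre-dichotomy S i
    with inject₁ i ∈? S | Fin.any? (λ s → (s ∈? S) ×-dec (inject₁ i Fin.<? s))
  ... | no i∉S  | _                     = inj₁ (pre-agrees S i λ i∈S → contradiction i∈S i∉S)
  ... | yes _   | yes (s , s∈S , i<s)   = inj₁ (pre-agrees S i λ _ → s , s∈S , inject₁<⇒suc≤ i i<s)
  ... | yes i∈S | no none               = inj₂ (i∈S , λ y y∈S → ≮⇒≥ λ i<y → none (y , y∈S , i<y))

  post-agrees : ∀ S i → (Fin.suc i ∈ S → ∃[ s ] (s ∈ S × s Fin.≤ inject₁ i)) →
                Post chain S ≡ Post (chainWithBackEdge i) S
  post-agrees S i below = Post-cong chain (chainWithBackEdge i) S λ v →
    mk⇔ (λ (s , s∈S , e) → s , s∈S , fromWitness (inj₁ (toWitness e)))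
        (λ (s , s∈S , e) → back v s s∈S (toWitness e))
    where
    back : ∀ v s → s ∈ S → Linked i s v → ∃[ s ] (s ∈ S × Edge chain s v)
    back v s s∈S (inj₁ s≤v)           = s , s∈S , fromWitness s≤v
    back v s s∈S (inj₂ (refl , refl)) =
      let s′ , s′∈S , s′≤i = below s∈S in s′ , s′∈S , fromWitness s′≤i

  -- Mirror image of `pre-dichotomy`: the back edge can only add `inject₁ i` to the successors, and
  -- any element of `S` below `suc i` already does so.
  post-dichotomy : ∀ S i → Post chain S ≡ Post (chainWithBackEdge i) S ⊎ IsMin S (suc i)
  post-dichotomy S i
    with Fin.suc i ∈? S | Fin.any? (λ s → (s ∈? S) ×-dec (s Fin.<? Fin.suc i))
  ... | no i∉S  | _                     = inj₁ (post-agrees S i λ i∈S → contradiction i∈S i∉S)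
  ... | yes _   | yes (s , s∈S , s<i)   = inj₁ (post-agrees S i λ _ → s , s∈S , <suc⇒≤inject₁ i s<i)
  ... | yes i∈S | no none               = inj₂ (i∈S , λ y y∈S → ≮⇒≥ λ y<i → none (y , y∈S , y<i))

  max-unique : ∀ {S i j} → IsMax S (inject₁ i) → IsMax S (inject₁ j) → i ≡ j
  max-unique (i∈S , i≥) (j∈S , j≥) = Fin.inject₁-injective (Fin.≤-antisym (j≥ _ i∈S) (i≥ _ j∈S))

  min-unique : ∀ {S} {i j : Fin m} → IsMin S (suc i) → IsMin S (suc j) → i ≡ j
  min-unique (i∈S , i≤) (j∈S , j≤) = Fin.suc-injective (Fin.≤-antisym (i≤ _ j∈S) (j≤ _ i∈S))

chain-diameter : ∀ {m} → DiameterAtMost 1 (chain {suc m})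
chain-diameter = diameter≤1 Fin._≤?_ Fin.≤-refl Fin.≤-trans {zero} {suc zero} z≤n λ ()

chainWithBackEdge-diameter : ∀ {m} (i : Fin (suc m)) → DiameterAtMost 1 (chainWithBackEdge i)
chainWithBackEdge-diameter i =
  diameter≤1 (linked? i) (linked-refl i) (linked-trans i) {zero} {suc zero} (inj₁ z≤n) λ ()

-- Assembly of the lower bound.

module _ {Out : ℕ → Set} (A : ∀ n → SymbolicAlgorithm n (Out n))
         (Correct : ∀ {n} → Graph n → Out n → Set) (Class : ∀ {n} → Graph n → Set) where

  solves⇒succeeds : Solves A Correct Class →
                    ∀ {n} (G : Graph n) → Class G → ∃ (Succeeds (A n) Correct G)
  solves⇒succeeds (inj₁ (_ , always)) {n} G G∈ =
    alwaysCorrect⇒succeeds (A n) Correct G (always n G G∈)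
  solves⇒succeeds (inj₂ bounded)      {n} G G∈ =
    boundedError⇒succeeds (A n) Correct G (bounded n G G∈)

mainTheorem2 : Σ ℕ λ d₀ → Σ ℚ λ c → (0ℚ ℚ.< c) ×
    ((A : SCCAlgorithm) →
    Solves A IsSetOfSCCs (DiameterAtMost d₀) →
    ∀ (N : ℕ) →
    ∃[ n ] (N ≤ n × (Σ (Graph n) λ G → DiameterAtMost d₀ G ×
    (∃[ t ] (Σ (Vec Bool t) λ r → c ℚ.* ℕ→ℚ n ℚ.≤ ℕ→ℚ (oneStepOps (A n) G r))))))
-- Preorder graphs have distances at most 1, whence `d₀`. With n = 2 + N vertices there are n - 1
-- back edges, so some run uses k operations with n - 1 ≤ 5k. Since n ≥ 2, doubling gives n ≤ 2(n -
-- 1) ≤ 10k, whence the constant 1/10.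
mainTheorem2 = 1 , + 1 ℚ./ 10 , toWitness {a? = _ ℚ.<? _} _ , λ A solves N →
  let t , r , bound = manyOps (A (2 + N)) chain chainWithBackEdge
        (λ S → (λ i → IsMax S (inject₁ i)) , pre-dichotomy S , max-unique)
        (λ S → (λ i → IsMin S (suc i)) , post-dichotomy S , min-unique)
        IsSetOfSCCs backEdge-incompatible
        (succeeds A solves chain chain-diameter)
        (λ i → succeeds A solves (chainWithBackEdge i) (chainWithBackEdge-diameter i))
  in 2 + N , m≤n+m N 2 , chain , chain-diameter , t , r ,
     ℚ-bound⁺ 1 9 (2 + N) (oneStepOps (A (2 + N)) chain r)
       (vertices≤ N (oneStepOps (A (2 + N)) chain r) bound)
  where
  succeeds : (A : SCCAlgorithm) → Solves A IsSetOfSCCs (DiameterAtMost 1) →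
             ∀ {n} (G : Graph n) → DiameterAtMost 1 G → ∃ (Succeeds (A n) IsSetOfSCCs G)
  succeeds A = solves⇒succeeds A IsSetOfSCCs (DiameterAtMost 1)

  vertices≤ : ∀ N k → 1 + N ≤ 5 * k → 1 * (2 + N) ≤ 10 * k
  vertices≤ N k le = begin
    1 * (2 + N)        ≡⟨ *-identityˡ (2 + N) ⟩
    1 + (1 + N)        ≤⟨ +-monoˡ-≤ (1 + N) (s≤s z≤n) ⟩
    (1 + N) + (1 + N)  ≤⟨ +-mono-≤ le le ⟩
    5 * k + 5 * k      ≡⟨ *-distribʳ-+ k 5 5 ⟨
    10 * k             ∎
    where open ≤-Reasoning
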